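{- For all $P,Q\in C_A$, $\mathrm{CP}_{rp}(A)\vdash P=Q$ if and only if $P=_{rpse}Q$, i.e. if and only if $rpse(P)=rpse(Q)$.
   Context: Let $A$ be a countable set (of atoms) with at least two elements. $C_A$ is the set of closed terms (conditional statements) over the signature with constants $T$, $F$, a constant $a$ for each $a\in A$, and one ternary operation $x\triangleleft y\triangleright z$ (the conditional, "if $y$ then $x$ else $z$"). $\mathrm{CP}$ is the set of equational axioms (in variables $x,y,z,u,v$): (CP1) $x\triangleleft T\triangleright y=x$; (CP2) $x\triangleleft F\triangleright y=y$; (CP3) $T\triangleleft x\triangleright F=x$; (CP4) $x\triangleleft(y\triangleleft z\triangleright u)\triangleright v=(x\triangleleft y\triangleright v)\triangleleft z\triangleright(x\triangleleft u\triangleright v)$. $\mathrm{CP}_{rp}(A)$ is $\mathrm{CP}$ extended with, for every $a\in A$, the axioms (CPrp1) $(x\triangleleft a\triangleright y)\triangleleft a\triangleright z=(x\triangleleft a\triangleright x)\triangleleft a\triangleright z$; (CPrp2) $x\triangleleft a\triangleright(y\triangleleft a\triangleright z)=x\triangleleft a\triangleright(z\triangleleft a\triangleright z)$. For a set $E$ of equational axioms, $E\vdash s=t$ means derivability in equational logic from $E$. Evaluation trees: the set $\mathcal T_A$ is defined inductively by $T\in\mathcal T_A$, $F\in\mathcal T_A$, and $(X\trianglelefteq a\trianglerighteq Y)\in\mathcal T_A$ for all $X,Y\in\mathcal T_A$, $a\in A$ (binary tree with root $a$, left branch $X$, right branch $Y$). Leaf replacement: for $Y,Z\in\mathcal T_A$,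 $X[T\mapsto Y,F\mapsto Z]$ is defined by $T[T\mapsto Y,F\mapsto Z]=Y$, $F[T\mapsto Y,F\mapsto Z]=Z$, $(X_1\trianglelefteq a\trianglerighteq X_2)[T\mapsto Y,F\mapsto Z]=X_1[T\mapsto Y,F\mapsto Z]\trianglelefteq a\trianglerighteq X_2[T\mapsto Y,F\mapsto Z]$. The short-circuit evaluation function $se:C_A\to\mathcal T_A$ is defined by $se(T)=T$, $se(F)=F$, $se(a)=T\trianglelefteq a\trianglerighteq F$ for $a\in A$, and $se(P\triangleleft Q\triangleright R)=se(Q)[T\mapsto se(P),F\mapsto se(R)]$. Repetition-proof evaluation trees: for $a\in A$ define $F_a,G_a:\mathcal T_A\to\mathcal T_A$ by $F_a(B)=G_a(B)=B$ for $B\in\{T,F\}$; $F_a(X\trianglelefteq a\trianglerighteq Y)=F_a(X)\trianglelefteq a\trianglerighteq F_a(X)$; $G_a(X\trianglelefteq a\trianglerighteq Y)=G_a(Y)\trianglelefteq a\trianglerighteq G_a(Y)$; and $F_a(X\trianglelefteq b\trianglerighteq Y)=G_a(X\trianglelefteq b\trianglerighteq Y)=X\trianglelefteq b\trianglerighteq Y$ if $b\neq a$. Define $rp:\mathcal T_A\to\mathcal T_A$ (by recursion on depth) by $rp(T)=T$, $rp(F)=F$, $rp(X\trianglelefteq a\trianglerighteq Y)=rp(F_a(X))\trianglelefteq a\trianglerighteq rp(G_a(Y))$. Then $rpse:C_A\to\mathcal T_A$ is $rpse(P)=rp(se(P))$, and repetition-proof valuation congruence is: $P=_{rpse}Q$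 iff $rpse(P)=rpse(Q)$. -}

module Defs where

open import Level using (Level; _⊔_)
open import Data.Empty using (⊥)
open import Data.Nat using (ℕ; suc; _≤_; _<_; s≤s) renaming (_⊔_ to _⊔ⁿ_)
open import Data.Nat.Induction using (<-wellFounded)
import Data.Nat.Properties as ℕₚ
open import Function.Bundles using (_↣_)
open import Induction.WellFounded using (WellFounded; WfRec; module All; module FixPoint)
open import Relation.Binary.Core using (Rel)
import Relation.Binary.Construct.On as On
open import Relation.Binary.Definitions using (DecidableEquality)
open import Relation.Binary.PropositionalEquality using (_≡_; refl; cong₂)
open import Relation.Nullary using (yes; no)

private
  variable
    ℓ ℓ′ ℓ″ : Level

-- Finite or countably infinite.
Countable : Set ℓ → Set ℓ
Countable A = A ↣ ℕ

------------------------------------------------------------------------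
-- Conditional statements and equational logic

infix 8 _◁_▷_

data Term (A : Set ℓ) (V : Set ℓ′) : Set (ℓ ⊔ ℓ′) where
  var   : V → Term A V
  T F   : Term A V
  atom  : A → Term A V
  _◁_▷_ : Term A V → Term A V → Term A V → Term A V

Closed : Set ℓ → Set ℓ
Closed A = Term A ⊥

Open : Set ℓ → Set ℓ
Open A = Term A ℕ

_⟪_⟫ : {A : Set ℓ} {V : Set ℓ′} {W : Set ℓ″} → Term A V → (V → Term A W) → Term A W
var i       ⟪ σ ⟫ = σ i
T           ⟪ σ ⟫ = T
F           ⟪ σ ⟫ = F
atom a      ⟪ σ ⟫ = atom a
(s ◁ t ▷ r) ⟪ σ ⟫ = (s ⟪ σ ⟫) ◁ (t ⟪ σ ⟫) ▷ (r ⟪ σ ⟫)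

-- Derivations range over open terms, so closed terms are embedded into them.
⌜_⌝ : {A : Set ℓ} → Closed A → Open A
⌜ P ⌝ = P ⟪ (λ ()) ⟫

infix 4 _⊢_≈_

-- A set E of equations is given as a relation: E s t says that s = t is
-- one of the axioms.
data _⊢_≈_ {A : Set ℓ} (E : Rel (Open A) ℓ′) : Rel (Open A) (ℓ ⊔ ℓ′) where
  ≈-axiom : ∀ {s t} → E s t → E ⊢ s ≈ t
  ≈-refl  : ∀ {s} → E ⊢ s ≈ s
  ≈-sym   : ∀ {s t} → E ⊢ s ≈ t → E ⊢ t ≈ s
  ≈-trans : ∀ {s t r} → E ⊢ s ≈ t → E ⊢ t ≈ r → E ⊢ s ≈ r
  ≈-cong  : ∀ {s s′ t t′ r r′} → E ⊢ s ≈ s′ → E ⊢ t ≈ t′ → E ⊢ r ≈ r′ →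
            E ⊢ s ◁ t ▷ r ≈ s′ ◁ t′ ▷ r′
  ≈-subst : ∀ {s t} (σ : ℕ → Open A) → E ⊢ s ≈ t → E ⊢ s ⟪ σ ⟫ ≈ t ⟪ σ ⟫

module _ (A : Set ℓ) where
  private
    x y z u v : Open A
    x = var 0
    y = var 1
    z = var 2
    u = var 3
    v = var 4

  data CP : Rel (Open A) ℓ where
    CP1 : CP (x ◁ T ▷ y) x
    CP2 : CP (x ◁ F ▷ y) y
    CP3 : CP (T ◁ x ▷ F) x
    CP4 : CP (x ◁ (y ◁ z ▷ u) ▷ v) ((x ◁ y ▷ v) ◁ z ▷ (x ◁ u ▷ v))

  data CPrp : Rel (Open A) ℓ where
    cp    : ∀ {s t} → CP s t → CPrp s t
    CPrp1 : (c : A) → CPrp ((x ◁ atom c ▷ y) ◁ atom c ▷ z)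
                           ((x ◁ atom c ▷ x) ◁ atom c ▷ z)
    CPrp2 : (c : A) → CPrp (x ◁ atom c ▷ (y ◁ atom c ▷ z))
                           (x ◁ atom c ▷ (z ◁ atom c ▷ z))

------------------------------------------------------------------------
-- Evaluation trees

infix 8 _⊴_⊵_

data Tree (A : Set ℓ) : Set ℓ where
  T F   : Tree A
  _⊴_⊵_ : Tree A → A → Tree A → Tree A

_[T↦_,F↦_] : {A : Set ℓ} → Tree A → Tree A → Tree A → Tree A
T             [T↦ Y ,F↦ Z ] = Y
F             [T↦ Y ,F↦ Z ] = Z
(X₁ ⊴ c ⊵ X₂) [T↦ Y ,F↦ Z ] = (X₁ [T↦ Y ,F↦ Z ]) ⊴ c ⊵ (X₂ [T↦ Y ,F↦ Z ])

se : {A : Set ℓ} → Closed A → Tree A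
se (var ())
se T           = T
se F           = F
se (atom c)    = T ⊴ c ⊵ F
se (P ◁ Q ▷ R) = se Q [T↦ se P ,F↦ se R ]

depth : {A : Set ℓ} → Tree A → ℕ
depth T           = 0
depth F           = 0
depth (X ⊴ _ ⊵ Y) = suc (depth X ⊔ⁿ depth Y)

module RepetitionProof {A : Set ℓ} (_≟_ : DecidableEquality A) where

  F[_] : A → Tree A → Tree A
  F[ c ] T = T
  F[ c ] F = F
  F[ c ] (X ⊴ d ⊵ Y) with d ≟ c
  ... | yes _ = F[ c ] X ⊴ d ⊵ F[ c ] X
  ... | no  _ = X ⊴ d ⊵ Y

  G[_] : A → Tree A → Tree A
  G[ c ] T = T
  G[ c ] F = F
  G[ c ] (X ⊴ d ⊵ Y) with d ≟ c
  ... | yes _ = G[ c ] Y ⊴ d ⊵ G[ c ] Y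
  ... | no  _ = X ⊴ d ⊵ Y

  depth-F : ∀ c X → depth (F[ c ] X) ≤ depth X
  depth-F c T = ℕₚ.≤-refl
  depth-F c F = ℕₚ.≤-refl
  depth-F c (X ⊴ d ⊵ Y) with d ≟ c
  ... | yes _ = s≤s (ℕₚ.⊔-lub X≤ X≤)
    where X≤ = ℕₚ.≤-trans (depth-F c X) (ℕₚ.m≤m⊔n (depth X) (depth Y))
  ... | no  _ = ℕₚ.≤-refl

  depth-G : ∀ c X → depth (G[ c ] X) ≤ depth X
  depth-G c T = ℕₚ.≤-refl
  depth-G c F = ℕₚ.≤-refl
  depth-G c (X ⊴ d ⊵ Y) with d ≟ c
  ... | yes _ = s≤s (ℕₚ.⊔-lub Y≤ Y≤)
    where Y≤ = ℕₚ.≤-trans (depth-G c Y) (ℕₚ.m≤n⊔m (depth X) (depth Y))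
  ... | no  _ = ℕₚ.≤-refl

  _≺_ : Rel (Tree A) _
  X ≺ Y = depth X < depth Y

  ≺-wellFounded : WellFounded _≺_
  ≺-wellFounded = On.wellFounded depth <-wellFounded

  F-≺ : ∀ X c Y → F[ c ] X ≺ (X ⊴ c ⊵ Y)
  F-≺ X c Y = s≤s (ℕₚ.≤-trans (depth-F c X) (ℕₚ.m≤m⊔n (depth X) (depth Y)))

  G-≺ : ∀ X c Y → G[ c ] Y ≺ (X ⊴ c ⊵ Y)
  G-≺ X c Y = s≤s (ℕₚ.≤-trans (depth-G c Y) (ℕₚ.m≤n⊔m (depth X) (depth Y)))

  rp-step : (X : Tree A) → WfRec _≺_ (λ _ → Tree A) X → Tree A
  rp-step T           rec = T
  rp-step F           rec = F
  rp-step (X ⊴ c ⊵ Y) rec = rec (F-≺ X c Y) ⊴ c ⊵ rec (G-≺ X c Y)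

  rp : Tree A → Tree A
  rp = All.wfRec ≺-wellFounded ℓ (λ _ → Tree A) rp-step

  rp-step-ext : (X : Tree A) {IH IH′ : WfRec _≺_ (λ _ → Tree A) X} →
                (∀ {Y} (Y≺X : Y ≺ X) → IH Y≺X ≡ IH′ Y≺X) →
                rp-step X IH ≡ rp-step X IH′
  rp-step-ext T           eq = refl
  rp-step-ext F           eq = refl
  rp-step-ext (X ⊴ c ⊵ Y) eq = cong₂ (_⊴ c ⊵_) (eq (F-≺ X c Y)) (eq (G-≺ X c Y))

  -- rp is defined by recursion on depth; these are its intended equations.
  rp-T : rp T ≡ T
  rp-T = refl

  rp-F : rp F ≡ F
  rp-F = refl

  rp-⊴⊵ : ∀ X c Y → rp (X ⊴ c ⊵ Y) ≡ rp (F[ c ] X) ⊴ c ⊵ rp (G[ c ] Y)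
  rp-⊴⊵ X c Y = FixPoint.unfold-wfRec ≺-wellFounded (λ _ → Tree A) rp-step rp-step-ext
                  {X ⊴ c ⊵ Y}

  rpse : Closed A → Tree A
  rpse P = rp (se P)

  infix 4 _=rpse_

  _=rpse_ : Rel (Closed A) ℓ
  P =rpse Q = rpse P ≡ rpse Q

{-# OPTIONS --safe #-}
-- The tree rp X can be computed by a structural recursion that carries the last
-- atom evaluated together with its reply.  In this form rp (Y [T↦ X ,F↦ Z ])
-- depends only on rp X, rp Y and rp Z, because normalising under a memory absorbs
-- any earlier normalisation under no memory; hence =rpse is a congruence, and the
-- axioms are sound for it.  Conversely CP proves each closed term equal to the
-- term that spells out its evaluation tree, and CPrp1 and CPrp2 carry out each
-- normalisation step on such terms, so that P and Q with rpse P = rpse Q have a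
-- common provable form.
module Submission where

open import Defs
open import Data.Bool using (Bool; true; false)
open import Data.Maybe using (Maybe; just; nothing)
open import Data.Nat using (ℕ)
open import Data.Product using (_×_; _,_; ∃₂)
open import Data.Nat.Properties using (eq?)
open import Function.Bundles using (_⇔_; mk⇔)
open import Level using (Level)
open import Relation.Binary.Bundles using (Setoid)
open import Relation.Binary.Core using (Rel)
open import Relation.Binary.Definitions using (DecidableEquality)
open import Relation.Binary.PropositionalEquality
  using (_≡_; _≢_; refl; sym; trans; cong; cong₂; module ≡-Reasoning)
open import Relation.Nullary using (yes; no; contradiction)
import Relation.Binary.Reasoning.Setoid as SetoidReasoning

private
  variable
    ℓ ℓ′ : Level

module _ {A : Set ℓ} where

  -- Leaf replacement and a tree model of open terms.

  replace-identity : (X : Tree A) → X [T↦ T ,F↦ F ] ≡ X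
  replace-identity T           = refl
  replace-identity F           = refl
  replace-identity (X ⊴ c ⊵ Y) = cong₂ (_⊴ c ⊵_) (replace-identity X) (replace-identity Y)

  replace-assoc : (W X Y Z Z′ : Tree A) →
    (W [T↦ X ,F↦ Y ]) [T↦ Z ,F↦ Z′ ] ≡ W [T↦ X [T↦ Z ,F↦ Z′ ] ,F↦ Y [T↦ Z ,F↦ Z′ ] ]
  replace-assoc T             X Y Z Z′ = refl
  replace-assoc F             X Y Z Z′ = refl
  replace-assoc (W₁ ⊴ c ⊵ W₂) X Y Z Z′ =
    cong₂ (_⊴ c ⊵_) (replace-assoc W₁ X Y Z Z′) (replace-assoc W₂ X Y Z Z′)

  -- A derivation between closed terms may pass through open ones, so soundness needs a value for
  -- these as well.
  ⟦_⟧ : Open A → (ℕ → Tree A) → Tree A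
  ⟦ var i ⟧     ρ = ρ i
  ⟦ T ⟧         ρ = T
  ⟦ F ⟧         ρ = F
  ⟦ atom c ⟧    ρ = T ⊴ c ⊵ F
  ⟦ s ◁ t ▷ r ⟧ ρ = ⟦ t ⟧ ρ [T↦ ⟦ s ⟧ ρ ,F↦ ⟦ r ⟧ ρ ]

  -- An arbitrary σ, because the empty function in the definition of ⌜ P ⌝ depends
  -- on P as a term, so that ⌜ P ◁ Q ▷ R ⌝ does not reduce to ⌜ P ⌝ ◁ ⌜ Q ⌝ ▷ ⌜ R ⌝.
  ⟦⟧-closed : ∀ σ ρ (P : Closed A) → ⟦ P ⟪ σ ⟫ ⟧ ρ ≡ se P
  ⟦⟧-closed σ ρ T           = refl
  ⟦⟧-closed σ ρ F           = refl
  ⟦⟧-closed σ ρ (atom c)    = refl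
  ⟦⟧-closed σ ρ (P ◁ Q ▷ R)
    rewrite ⟦⟧-closed σ ρ P | ⟦⟧-closed σ ρ Q | ⟦⟧-closed σ ρ R = refl

  ⟦⟧-⟪⟫ : ∀ σ ρ (s : Open A) → ⟦ s ⟪ σ ⟫ ⟧ ρ ≡ ⟦ s ⟧ (λ i → ⟦ σ i ⟧ ρ)
  ⟦⟧-⟪⟫ σ ρ (var i)     = refl
  ⟦⟧-⟪⟫ σ ρ T           = refl
  ⟦⟧-⟪⟫ σ ρ F           = refl
  ⟦⟧-⟪⟫ σ ρ (atom c)    = refl
  ⟦⟧-⟪⟫ σ ρ (s ◁ t ▷ r) rewrite ⟦⟧-⟪⟫ σ ρ s | ⟦⟧-⟪⟫ σ ρ t | ⟦⟧-⟪⟫ σ ρ r = refl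

  -- Instances of the axioms and derivable basic forms.

  ⊢-setoid : Rel (Open A) ℓ′ → Setoid _ _
  ⊢-setoid E = record
    { Carrier       = Open A
    ; _≈_           = E ⊢_≈_
    ; isEquivalence = record { refl = ≈-refl ; sym = ≈-sym ; trans = ≈-trans }
    }

  instantiate : (x y z u v : Open A) → ℕ → Open A
  instantiate x y z u v 0 = x
  instantiate x y z u v 1 = y
  instantiate x y z u v 2 = z
  instantiate x y z u v 3 = u
  instantiate x y z u v _ = v

  cp1 : ∀ x y → CPrp A ⊢ x ◁ T ▷ y ≈ x
  cp1 x y = ≈-subst (instantiate x y T T T) (≈-axiom (cp CP1))

  cp2 : ∀ x y → CPrp A ⊢ x ◁ F ▷ y ≈ y
  cp2 x y = ≈-subst (instantiate x y T T T) (≈-axiom (cp CP2))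

  cp3 : ∀ x → CPrp A ⊢ T ◁ x ▷ F ≈ x
  cp3 x = ≈-subst (instantiate x T T T T) (≈-axiom (cp CP3))

  cp4 : ∀ x y z u v → CPrp A ⊢ x ◁ (y ◁ z ▷ u) ▷ v ≈ (x ◁ y ▷ v) ◁ z ▷ (x ◁ u ▷ v)
  cp4 x y z u v = ≈-subst (instantiate x y z u v) (≈-axiom (cp CP4))

  cprp1 : ∀ c x y z → CPrp A ⊢ (x ◁ atom c ▷ y) ◁ atom c ▷ z ≈ (x ◁ atom c ▷ x) ◁ atom c ▷ z
  cprp1 c x y z = ≈-subst (instantiate x y z T T) (≈-axiom (CPrp1 c))

  cprp2 : ∀ c x y z → CPrp A ⊢ x ◁ atom c ▷ (y ◁ atom c ▷ z) ≈ x ◁ atom c ▷ (z ◁ atom c ▷ z)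
  cprp2 c x y z = ≈-subst (instantiate x y z T T) (≈-axiom (CPrp2 c))

  -- These are the basic forms of proposition algebra: every condition is an atom.
  ⌈_⌉ : Tree A → Open A
  ⌈ T ⌉         = T
  ⌈ F ⌉         = F
  ⌈ X ⊴ c ⊵ Y ⌉ = ⌈ X ⌉ ◁ atom c ▷ ⌈ Y ⌉

  ⌈⌉-replace : ∀ X Y Z → CPrp A ⊢ ⌈ X ⌉ ◁ ⌈ Y ⌉ ▷ ⌈ Z ⌉ ≈ ⌈ Y [T↦ X ,F↦ Z ] ⌉
  ⌈⌉-replace X T             Z = cp1 _ _
  ⌈⌉-replace X F             Z = cp2 _ _
  ⌈⌉-replace X (Y₁ ⊴ c ⊵ Y₂) Z =
    -- `cp4` distributes the outer conditional over the root atom, just as leaf replacement descends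
    -- into both branches.
    ≈-trans (cp4 _ _ _ _ _) (≈-cong (⌈⌉-replace X Y₁ Z) ≈-refl (⌈⌉-replace X Y₂ Z))

  closed≈⌈se⌉ : ∀ σ (P : Closed A) → CPrp A ⊢ P ⟪ σ ⟫ ≈ ⌈ se P ⌉
  closed≈⌈se⌉ σ T           = ≈-refl
  closed≈⌈se⌉ σ F           = ≈-refl
  closed≈⌈se⌉ σ (atom c)    = ≈-sym (cp3 _)
  closed≈⌈se⌉ σ (P ◁ Q ▷ R) =
    ≈-trans (≈-cong (closed≈⌈se⌉ σ P) (closed≈⌈se⌉ σ Q) (closed≈⌈se⌉ σ R))
            (⌈⌉-replace (se P) (se Q) (se R))

-- Normalisation with a memory.

module Normalisation {A : Set ℓ} (_≟_ : DecidableEquality A) where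
  open RepetitionProof _≟_

  -- The last atom evaluated, with its reply.
  Memory : Set ℓ
  Memory = Maybe (A × Bool)

  recall : Memory → A → Maybe Bool
  recall nothing        c = nothing
  recall (just (d , b)) c with c ≟ d
  ... | yes _ = just b
  ... | no  _ = nothing

  recall-just : ∀ m {c b} → recall m c ≡ just b → m ≡ just (c , b)
  recall-just (just (d , b)) {c} eq with c ≟ d
  recall-just (just (d , b)) refl | yes refl = refl

  -- A repeated atom repeats its reply, so the reachable branch overwrites the other one and the
  -- memory stays `m`. Recursion is on subtrees only, whereas `rp` recurses on outputs of `F[ c ]`
  -- and `G[ c ]`.
  nf : Memory → Tree A → Tree A
  nf m T = T
  nf m F = F
  nf m (X ⊴ c ⊵ Y) with recall m c
  ... | just true  = nf m X ⊴ c ⊵ nf m X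
  ... | just false = nf m Y ⊴ c ⊵ nf m Y
  ... | nothing    = nf (just (c , true)) X ⊴ c ⊵ nf (just (c , false)) Y

  -- When the root atom repeats, `rp` applies `F[ c ]` and `G[ c ]` to a tree already processed for
  -- `c`. This law and the next three absorb that second pass.
  F-F : ∀ c X → F[ c ] (F[ c ] X) ≡ F[ c ] X
  F-F c T = refl
  F-F c F = refl
  F-F c (X ⊴ d ⊵ Y) with d ≟ c in eq
  ... | yes _ rewrite eq | F-F c X = refl
  ... | no  _ rewrite eq = refl

  G-F : ∀ c X → G[ c ] (F[ c ] X) ≡ F[ c ] X
  G-F c T = refl
  G-F c F = refl
  G-F c (X ⊴ d ⊵ Y) with d ≟ c in eq
  ... | yes _ rewrite eq | G-F c X = refl
  ... | no  _ rewrite eq = refl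

  F-G : ∀ c X → F[ c ] (G[ c ] X) ≡ G[ c ] X
  F-G c T = refl
  F-G c F = refl
  F-G c (X ⊴ d ⊵ Y) with d ≟ c in eq
  ... | yes _ rewrite eq | F-G c Y = refl
  ... | no  _ rewrite eq = refl

  G-G : ∀ c X → G[ c ] (G[ c ] X) ≡ G[ c ] X
  G-G c T = refl
  G-G c F = refl
  G-G c (X ⊴ d ⊵ Y) with d ≟ c in eq
  ... | yes _ rewrite eq | G-G c Y = refl
  ... | no  _ rewrite eq = refl

  -- At a different atom the left branch continues with reply `true` and the right one with `false`,
  -- so the two lemmas need a mutual induction.
  nf-F : ∀ c X → nf (just (c , true)) X ≡ rp (F[ c ] X)
  nf-G : ∀ c X → nf (just (c , false)) X ≡ rp (G[ c ] X)

  nf-F c T = refl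
  nf-F c F = refl
  nf-F c (X ⊴ d ⊵ Y) with d ≟ c
  ... | yes refl rewrite rp-⊴⊵ (F[ c ] X) c (F[ c ] X) | F-F c X | G-F c X | nf-F c X = refl
  ... | no  _    rewrite rp-⊴⊵ X d Y | nf-F d X | nf-G d Y = refl

  nf-G c T = refl
  nf-G c F = refl
  nf-G c (X ⊴ d ⊵ Y) with d ≟ c
  ... | yes refl rewrite rp-⊴⊵ (G[ c ] Y) c (G[ c ] Y) | F-G c Y | G-G c Y | nf-G c Y = refl
  ... | no  _    rewrite rp-⊴⊵ X d Y | nf-F d X | nf-G d Y = refl

  nf≡rp : ∀ X → nf nothing X ≡ rp X
  nf≡rp T = refl
  nf≡rp F = refl
  nf≡rp (X ⊴ c ⊵ Y) rewrite rp-⊴⊵ X c Y | nf-F c X | nf-G c Y = refl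

  -- The outer pass reaches each node of `nf m Y` with the memory that the inner pass had there, so
  -- it repeats the same choices and enters the leaves with the same memories.
  nf-replace-nf : ∀ m Y X Z → nf m (nf m Y [T↦ X ,F↦ Z ]) ≡ nf m (Y [T↦ X ,F↦ Z ])
  nf-replace-nf m T X Z = refl
  nf-replace-nf m F X Z = refl
  nf-replace-nf m (Y₁ ⊴ c ⊵ Y₂) X Z with recall m c in eq
  ... | just true  rewrite eq | nf-replace-nf m Y₁ X Z = refl
  ... | just false rewrite eq | nf-replace-nf m Y₂ X Z = refl
  ... | nothing    rewrite eq | nf-replace-nf (just (c , true)) Y₁ X Z
                              | nf-replace-nf (just (c , false)) Y₂ X Z = refl

  -- The passes differ in memory only at the root: below it, on every branch that the outer pass
  -- keeps, both remember the root atom with the same reply.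
  nf-replace-nf₀ : ∀ m Y X Z → nf m (nf nothing Y [T↦ X ,F↦ Z ]) ≡ nf m (Y [T↦ X ,F↦ Z ])
  nf-replace-nf₀ m T X Z = refl
  nf-replace-nf₀ m F X Z = refl
  nf-replace-nf₀ m (Y₁ ⊴ c ⊵ Y₂) X Z with recall m c in eq
  -- Recalling `true` for `c` forces `m` to be `just (c , true)`, which is the memory with which the
  -- inner pass enters `Y₁`.
  ... | just true  rewrite recall-just m eq | nf-replace-nf (just (c , true)) Y₁ X Z = refl
  ... | just false rewrite recall-just m eq | nf-replace-nf (just (c , false)) Y₂ X Z = refl
  ... | nothing    rewrite nf-replace-nf (just (c , true)) Y₁ X Z
                         | nf-replace-nf (just (c , false)) Y₂ X Z = refl

  nf-nf₀ : ∀ m X → nf m (nf nothing X) ≡ nf m X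
  nf-nf₀ m X = begin
    nf m (nf nothing X)                ≡⟨ cong (nf m) (replace-identity (nf nothing X)) ⟨
    nf m (nf nothing X [T↦ T ,F↦ F ])  ≡⟨ nf-replace-nf₀ m X T F ⟩
    nf m (X [T↦ T ,F↦ F ])             ≡⟨ cong (nf m) (replace-identity X) ⟩
    nf m X                             ∎
    where open ≡-Reasoning

  -- Congruence of having equal normal forms.

  infix 4 _∼_

  _∼_ : Rel (Tree A) ℓ
  X ∼ Y = nf nothing X ≡ nf nothing Y

  -- Trees grafted at leaves are entered in mid-evaluation, where the memory need not be empty.
  ∼⇒nf≡ : ∀ m X Y → X ∼ Y → nf m X ≡ nf m Y
  ∼⇒nf≡ m X Y X∼Y = begin
    nf m X               ≡⟨ nf-nf₀ m X ⟨
    nf m (nf nothing X)  ≡⟨ cong (nf m) X∼Y ⟩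
    nf m (nf nothing Y)  ≡⟨ nf-nf₀ m Y ⟩
    nf m Y               ∎
    where open ≡-Reasoning

  nf-replace-leaves : ∀ m Y X X′ Z Z′ → X ∼ X′ → Z ∼ Z′ →
    nf m (Y [T↦ X ,F↦ Z ]) ≡ nf m (Y [T↦ X′ ,F↦ Z′ ])
  nf-replace-leaves m T X X′ Z Z′ X∼ Z∼ = ∼⇒nf≡ m X X′ X∼
  nf-replace-leaves m F X X′ Z Z′ X∼ Z∼ = ∼⇒nf≡ m Z Z′ Z∼
  nf-replace-leaves m (Y₁ ⊴ c ⊵ Y₂) X X′ Z Z′ X∼ Z∼ with recall m c
  ... | just true  = cong (λ W → W ⊴ c ⊵ W) (nf-replace-leaves m Y₁ X X′ Z Z′ X∼ Z∼)
  ... | just false = cong (λ W → W ⊴ c ⊵ W) (nf-replace-leaves m Y₂ X X′ Z Z′ X∼ Z∼)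
  ... | nothing    = cong₂ (_⊴ c ⊵_) (nf-replace-leaves _ Y₁ X X′ Z Z′ X∼ Z∼)
                                     (nf-replace-leaves _ Y₂ X X′ Z Z′ X∼ Z∼)

  ∼-replace : ∀ X X′ Y Y′ Z Z′ → X ∼ X′ → Y ∼ Y′ → Z ∼ Z′ →
    Y [T↦ X ,F↦ Z ] ∼ Y′ [T↦ X′ ,F↦ Z′ ]
  ∼-replace X X′ Y Y′ Z Z′ X∼ Y∼ Z∼ = begin
    nf nothing (Y [T↦ X ,F↦ Z ])               ≡⟨ nf-replace-nf₀ nothing Y X Z ⟨
    nf nothing (nf nothing Y [T↦ X ,F↦ Z ])    ≡⟨ cong (λ W → nf nothing (W [T↦ X ,F↦ Z ])) Y∼ ⟩
    nf nothing (nf nothing Y′ [T↦ X ,F↦ Z ])   ≡⟨ nf-replace-nf₀ nothing Y′ X Z ⟩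
    nf nothing (Y′ [T↦ X ,F↦ Z ])              ≡⟨ nf-replace-leaves nothing Y′ X X′ Z Z′ X∼ Z∼ ⟩
    nf nothing (Y′ [T↦ X′ ,F↦ Z′ ])            ∎
    where open ≡-Reasoning

  -- Soundness of derivations in the tree model.

  recall-self : ∀ c b → recall (just (c , b)) c ≡ just b
  recall-self c b with c ≟ c
  ... | yes _  = refl
  ... | no c≢c = contradiction refl c≢c

  axiom-sound : ∀ {s t} → CPrp A s t → ∀ ρ → ⟦ s ⟧ ρ ∼ ⟦ t ⟧ ρ
  axiom-sound (cp CP1)  ρ = refl
  axiom-sound (cp CP2)  ρ = refl
  axiom-sound (cp CP3)  ρ = cong (nf nothing) (replace-identity (ρ 0))
  axiom-sound (cp CP4)  ρ = cong (nf nothing) (replace-assoc (ρ 2) (ρ 1) (ρ 3) (ρ 0) (ρ 4))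
  axiom-sound (CPrp1 c) ρ rewrite recall-self c true = refl
  axiom-sound (CPrp2 c) ρ rewrite recall-self c false = refl

  sound : ∀ {s t} → CPrp A ⊢ s ≈ t → ∀ ρ → ⟦ s ⟧ ρ ∼ ⟦ t ⟧ ρ
  sound (≈-axiom ax)    ρ = axiom-sound ax ρ
  sound ≈-refl          ρ = refl
  sound (≈-sym p)       ρ = sym (sound p ρ)
  sound (≈-trans p q)   ρ = trans (sound p ρ) (sound q ρ)
  sound (≈-cong {s} {s′} {t} {t′} {r} {r′} p q o) ρ =
    ∼-replace (⟦ s ⟧ ρ) (⟦ s′ ⟧ ρ) (⟦ t ⟧ ρ) (⟦ t′ ⟧ ρ) (⟦ r ⟧ ρ) (⟦ r′ ⟧ ρ)
      (sound p ρ) (sound q ρ) (sound o ρ)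
  -- The substitution is absorbed into the valuation, so the induction must range over all `ρ`.
  sound (≈-subst {s} {t} σ p) ρ rewrite ⟦⟧-⟪⟫ σ ρ s | ⟦⟧-⟪⟫ σ ρ t = sound p _

  -- Derivability of normalisation.

  ⌈nf⌉-left  : ∀ c X u → CPrp A ⊢ ⌈ X ⌉ ◁ atom c ▷ u ≈ ⌈ nf (just (c , true)) X ⌉ ◁ atom c ▷ u
  -- A term need not be provably equal to its normal form under a nonempty memory. The surrounding
  -- `atom c` makes the step derivable, with the side of the branch giving the reply.
  ⌈nf⌉-right : ∀ c X u → CPrp A ⊢ u ◁ atom c ▷ ⌈ X ⌉ ≈ u ◁ atom c ▷ ⌈ nf (just (c , false)) X ⌉

  ⌈nf⌉-left c T u = ≈-refl
  ⌈nf⌉-left c F u = ≈-refl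
  ⌈nf⌉-left c (X ⊴ d ⊵ Y) u with d ≟ c
  ... | yes refl = begin
    -- The inner `atom c` is the context for the induction hypothesis, since the memory is
    -- unchanged; `cprp1` then copies the result to the other side.
    (⌈ X ⌉ ◁ atom c ▷ ⌈ Y ⌉) ◁ atom c ▷ u  ≈⟨ ≈-cong (⌈nf⌉-left c X _) ≈-refl ≈-refl ⟩
    (x′ ◁ atom c ▷ ⌈ Y ⌉) ◁ atom c ▷ u     ≈⟨ cprp1 c _ _ _ ⟩
    (x′ ◁ atom c ▷ x′) ◁ atom c ▷ u        ∎
    where
    open SetoidReasoning (⊢-setoid (CPrp A))
    x′ = ⌈ nf (just (c , true)) X ⌉
  -- A different atom `d` replaces the memory, so both branches are normalised in the context of
  -- `d`.
  ... | no _ = ≈-cong (≈-trans (⌈nf⌉-left d X _) (⌈nf⌉-right d Y _)) ≈-refl ≈-refl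

  ⌈nf⌉-right c T u = ≈-refl
  ⌈nf⌉-right c F u = ≈-refl
  ⌈nf⌉-right c (X ⊴ d ⊵ Y) u with d ≟ c
  ... | yes refl = begin
    u ◁ atom c ▷ (⌈ X ⌉ ◁ atom c ▷ ⌈ Y ⌉)  ≈⟨ ≈-cong ≈-refl ≈-refl (⌈nf⌉-right c Y _) ⟩
    u ◁ atom c ▷ (⌈ X ⌉ ◁ atom c ▷ y′)     ≈⟨ cprp2 c _ _ _ ⟩
    u ◁ atom c ▷ (y′ ◁ atom c ▷ y′)        ∎
    where
    open SetoidReasoning (⊢-setoid (CPrp A))
    y′ = ⌈ nf (just (c , false)) Y ⌉
  ... | no _ = ≈-cong ≈-refl ≈-refl (≈-trans (⌈nf⌉-left d X _) (⌈nf⌉-right d Y _))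

  ⌈⌉≈⌈nf⌉ : ∀ X → CPrp A ⊢ ⌈ X ⌉ ≈ ⌈ nf nothing X ⌉
  ⌈⌉≈⌈nf⌉ T           = ≈-refl
  ⌈⌉≈⌈nf⌉ F           = ≈-refl
  ⌈⌉≈⌈nf⌉ (X ⊴ c ⊵ Y) = ≈-trans (⌈nf⌉-left c X _) (⌈nf⌉-right c Y _)

  -- The two directions for closed terms.

  rpse-sound : ∀ P Q → CPrp A ⊢ ⌜ P ⌝ ≈ ⌜ Q ⌝ → P =rpse Q
  rpse-sound P Q p = begin
    rp (se P)               ≡⟨ nf≡rp (se P) ⟨
    nf nothing (se P)       ≡⟨ cong (nf nothing) (⟦⟧-closed _ ρ P) ⟨
    nf nothing (⟦ ⌜ P ⌝ ⟧ ρ)  ≡⟨ sound p ρ ⟩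
    nf nothing (⟦ ⌜ Q ⌝ ⟧ ρ)  ≡⟨ cong (nf nothing) (⟦⟧-closed _ ρ Q) ⟩
    nf nothing (se Q)       ≡⟨ nf≡rp (se Q) ⟩
    rp (se Q)               ∎
    where
    open ≡-Reasoning
    ρ : ℕ → Tree A
    -- The choice is arbitrary: the value of a closed term is the same under every valuation.
    ρ _ = T

  ⌜⌝≈⌈rpse⌉ : ∀ P → CPrp A ⊢ ⌜ P ⌝ ≈ ⌈ rpse P ⌉
  ⌜⌝≈⌈rpse⌉ P = begin
    ⌜ P ⌝                  ≈⟨ closed≈⌈se⌉ _ P ⟩
    ⌈ se P ⌉               ≈⟨ ⌈⌉≈⌈nf⌉ (se P) ⟩
    ⌈ nf nothing (se P) ⌉  ≡⟨ cong ⌈_⌉ (nf≡rp (se P)) ⟩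
    ⌈ rpse P ⌉             ∎
    where open SetoidReasoning (⊢-setoid (CPrp A))

  rpse-complete : ∀ P Q → P =rpse Q → CPrp A ⊢ ⌜ P ⌝ ≈ ⌜ Q ⌝
  rpse-complete P Q eq = begin
    ⌜ P ⌝       ≈⟨ ⌜⌝≈⌈rpse⌉ P ⟩
    ⌈ rpse P ⌉  ≡⟨ cong ⌈_⌉ eq ⟩
    ⌈ rpse Q ⌉  ≈⟨ ⌜⌝≈⌈rpse⌉ Q ⟨
    ⌜ Q ⌝       ∎
    where open SetoidReasoning (⊢-setoid (CPrp A))

theorem3p17 : ∀ {ℓ} (A : Set ℓ) (countable : Countable A) → (∃₂ λ (a b : A) → a ≢ b) →
    let open RepetitionProof (eq? countable) in
    (P Q : Closed A) → (CPrp A ⊢ ⌜ P ⌝ ≈ ⌜ Q ⌝) ⇔ (P =rpse Q)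
theorem3p17 A countable _ P Q = mk⇔ (rpse-sound P Q) (rpse-complete P Q)
  where open Normalisation (eq? countable)
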